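{- For every integer $k\geq 5$, the graph $G_k$ defined in the context satisfies $\operatorname{sdiam}_k(G_k)=k+3$ and $\operatorname{srad}_k(G_k)=k+1$.
   Context: Graphs are finite, simple and undirected. The size of a graph is its number of edges. For a connected graph $G$ and a non-empty set $S\subseteq V(G)$, the Steiner distance $d(S)$ is the minimum size (number of edges) of a connected subgraph of $G$ containing all vertices of $S$. For an integer $k$ with $2\le k\le |V(G)|$ and $v\in V(G)$, the Steiner $k$-eccentricity of $v$ is $\operatorname{e}_k(v)=\max\{d(S): S\subseteq V(G),\ |S|=k,\ v\in S\}$. The Steiner $k$-radius is $\operatorname{srad}_k(G)=\min\{\operatorname{e}_k(v):v\in V(G)\}$ and the Steiner $k$-diameter is $\operatorname{sdiam}_k(G)=\max\{\operatorname{e}_k(v):v\in V(G)\}$. Construction of $G_k$ for an integer $k\ge 5$: let $m=\lceil \frac{k+1}{2}\rceil$. Start with $k$ independent vertices $D=\{d_1,\ldots,d_k\}$ and put $D_1=\{d_1,\ldots,d_m\}$ and $D_2=\{d_m,d_{m+1},\ldots,d_k\}$ (so $D_1\cap D_2=\{d_m\}$). For each $d_i\in D_1$ add a new vertex $a_i$ adjacent to exactly the vertices of $D_1\setminus\{d_i\}$, and let $A$ be the set of all the $a_i$ ($1\le i\le m$). For each $d_j\in D_2$ add a new vertex $b_j$ adjacent to exactly the vertices of $D_2\setminus\{d_j\}$, and let $B$ be the set of all the $b_j$ ($m\le j\le k$). Finally add a new vertex $r$ adjacent to every vertex of $A\cup B$ (and to no other vertex). There are no further vertices or edges. -}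

module Defs where

open import Data.Irrelevant using ([_])
open import Data.List using (List; []; _∷_; _++_; concatMap; length; map; upTo)
open import Data.List.Membership.Propositional using (_∈_)
open import Data.List.Membership.Propositional.Properties
  using (∈-++⁺ˡ; ∈-++⁺ʳ; ∈-concatMap⁺; ∈-map⁺; ∈-upTo⁺)
open import Data.List.Relation.Binary.Subset.Propositional using (_⊆_)
open import Data.List.Relation.Unary.AllPairs using (AllPairs)
open import Data.List.Relation.Unary.Any as Any using (here; there)
open import Data.List.Relation.Unary.Unique.Propositional using (Unique)
open import Data.Nat using (ℕ; suc; _≤_; s≤s; z≤n; ⌈_/2⌉; _≟_; _≤?_)
open import Data.Nat.Properties
  using (≤-refl; ≤-trans; ≤-pred; <⇒≤; <⇒≢; ≰⇒>; ⌈n/2⌉-mono; ⌈n/2⌉<n)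
open import Data.Product using (∃-syntax; _×_; _,_; proj₂; swap)
open import Data.Refinement using (Refinement-syntax; value; _,_)
open import Level using (0ℓ)
open import Relation.Binary using (Rel; Symmetric; Irreflexive)
open import Relation.Binary.Construct.Closure.Equivalence using (EqClosure)
open import Relation.Binary.Construct.Closure.ReflexiveTransitive
  using (Star; ε; _◅_; _◅◅_; reverse)
open import Relation.Binary.Construct.Closure.Symmetric
  using (SymClosure; fwd; bwd; symmetric)
open import Relation.Binary.PropositionalEquality using (_≡_; _≢_; refl; ≢-sym)
open import Relation.Nullary using (Dec; yes; no; contradiction; recompute)
open import Relation.Nullary.Decidable using (_×-dec_)

IsMinimum IsMaximum : (ℕ → Set) → ℕ → Set
IsMinimum P x = P x × (∀ y → P y → x ≤ y)
IsMaximum P x = P x × (∀ y → P y → y ≤ x)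

record Graph : Set₁ where
  infix 4 _~_
  field
    Vertex   : Set
    vertices : List Vertex
    complete : ∀ v → v ∈ vertices
    _~_      : Rel Vertex 0ℓ
    ~-sym    : Symmetric _~_
    ~-irrefl : Irreflexive _≡_ _~_

Connected : Graph → Set
Connected G = ∀ u v → Star _~_ u v
  where open Graph G

record ConnectedGraph : Set₁ where
  field
    graph     : Graph
    connected : Connected graph
  open Graph graph public

-- An undirected edge uv is listed once, as (u , v) or as (v , u), so that
-- the length of the list of edges is the number of edges.  The list of
-- vertices matters only up to membership.
record Subgraph (G : Graph) : Set where
  open Graph G
  field
    verts      : List Vertex
    edges      : List (Vertex × Vertex)
    distinct   : AllPairs (λ e f → e ≢ f × swap e ≢ f) edges
    adjacent   : ∀ {u v} → (u , v) ∈ edges → u ~ v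
    endpoints  : ∀ {u v} → (u , v) ∈ edges → u ∈ verts × v ∈ verts

  size : ℕ
  size = length edges

  IsConnected : Set
  IsConnected = ∀ {u v} → u ∈ verts → v ∈ verts →
                EqClosure (λ x y → (x , y) ∈ edges) u v

-- The invariants are functional relations: SteinerDistance S x says
-- d(S) = x, Eccentricity k v x says e_k(v) = x, and so on.
module _ (G : ConnectedGraph) where
  open ConnectedGraph G
  open Subgraph

  SteinerDistance : List Vertex → ℕ → Set
  SteinerDistance S = IsMinimum λ x →
    ∃[ H ] IsConnected {graph} H × S ⊆ verts H × size H ≡ x

  -- A set of k vertices is a repetition-free list of length k.
  Eccentricity : ℕ → Vertex → ℕ → Set
  Eccentricity k v = IsMaximum λ x →
    ∃[ S ] Unique S × length S ≡ k × v ∈ S × SteinerDistance S x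

  SteinerRadius : ℕ → ℕ → Set
  SteinerRadius k = IsMinimum λ x → ∃[ v ] Eccentricity k v x

  SteinerDiameter : ℕ → ℕ → Set
  SteinerDiameter k = IsMaximum λ x → ∃[ v ] Eccentricity k v x

Range : ℕ → ℕ → Set
Range lo hi = [ i ∈ ℕ ∣ lo ≤ i × i ≤ hi ]

inRange? : ∀ lo hi i → Dec (lo ≤ i × i ≤ hi)
inRange? lo hi i = (lo ≤? i) ×-dec (i ≤? hi)

bounds : ∀ {lo hi} (i : Range lo hi) → lo ≤ value i × value i ≤ hi
bounds (i , [ p ]) = recompute (inRange? _ _ i) p

range : ∀ lo hi → List (Range lo hi)
range lo hi = concatMap candidate (upTo (suc hi))
  module Range-candidate where
  candidate : ℕ → List (Range lo hi)
  candidate i with inRange? lo hi i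
  ... | yes p = (i , [ p ]) ∷ []
  ... | no  _ = []

∈-range : ∀ {lo hi} (i : Range lo hi) → i ∈ range lo hi
∈-range {lo} {hi} i@(n , _) =
  ∈-concatMap⁺ candidate (Any.map (λ { refl → hit }) (∈-upTo⁺ (s≤s (proj₂ (bounds i)))))
  where
  open Range-candidate lo hi
  hit : i ∈ candidate n
  hit with inRange? lo hi n
  ... | yes _ = here refl
  ... | no ¬p = contradiction (bounds i) ¬p

module Construction (k : ℕ) where

  m : ℕ
  m = ⌈ suc k /2⌉

  data V : Set where
    d : Range 1 k → V
    a : Range 1 m → V
    b : Range m k → V
    r : V

  -- D₁ consists of the d j with j ≤ m, and D₂ of those with m ≤ j.
  data Edge : Rel V 0ℓ where
    a-d : ∀ {i j} → value j ≤ m → value j ≢ value i → Edge (a i) (d j)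
    b-d : ∀ {i j} → m ≤ value j → value j ≢ value i → Edge (b i) (d j)
    r-a : ∀ {i} → Edge r (a i)
    r-b : ∀ {i} → Edge r (b i)

  allV : List V
  allV = r ∷ map d (range 1 k) ++ map a (range 1 m) ++ map b (range m k)

  ∈-allV : ∀ v → v ∈ allV
  ∈-allV (d i) = there (∈-++⁺ˡ (∈-map⁺ d (∈-range i)))
  ∈-allV (a i) = there (∈-++⁺ʳ (map d (range 1 k)) (∈-++⁺ˡ (∈-map⁺ a (∈-range i))))
  ∈-allV (b i) = there (∈-++⁺ʳ (map d (range 1 k))
                         (∈-++⁺ʳ (map a (range 1 m)) (∈-map⁺ b (∈-range i))))
  ∈-allV r     = here refl

  irrefl : Irreflexive _≡_ (SymClosure Edge)
  irrefl refl (fwd ())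
  irrefl refl (bwd ())

  graph : Graph
  graph = record
    { Vertex   = V
    ; vertices = allV
    ; complete = ∈-allV
    ; _~_      = SymClosure Edge
    ; ~-sym    = symmetric Edge
    ; ~-irrefl = irrefl
    }

  connected : 5 ≤ k → Connected graph
  connected 5≤k u v = to-r u ◅◅ reverse (symmetric Edge) (to-r v)
    where
    2≤m : 2 ≤ m
    2≤m = ≤-trans (s≤s (s≤s z≤n)) (⌈n/2⌉-mono (s≤s 5≤k))

    m≤k : ∀ {k} → 5 ≤ k → ⌈ suc k /2⌉ ≤ k
    m≤k {suc k} _ = ≤-pred (⌈n/2⌉<n k)

    to-r : ∀ v → Star (SymClosure Edge) v r
    to-r r     = ε
    to-r (a _) = bwd r-a ◅ ε
    to-r (b _) = bwd r-b ◅ ε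
    to-r (d j) with value j ≤? m
    ... | no j≰m = bwd (b-d {m , [ ≤-refl , m≤k 5≤k ]} (<⇒≤ (≰⇒> j≰m)) (≢-sym (<⇒≢ (≰⇒> j≰m))))
                   ◅ bwd r-b ◅ ε
    ... | yes j≤m with value j ≟ 1
    ...   | no  j≢1 = bwd (a-d {1 , [ s≤s z≤n , <⇒≤ 2≤m ]} j≤m j≢1) ◅ bwd r-a ◅ ε
    ...   | yes j≡1 = bwd (a-d {2 , [ s≤s z≤n , 2≤m ]} j≤m λ j≡2 → 1≢2 j≡1 j≡2)
                      ◅ bwd r-a ◅ ε
      where
      1≢2 : ∀ {n} → n ≡ 1 → n ≢ 2
      1≢2 refl ()

G : (k : ℕ) → 5 ≤ k → ConnectedGraph
G k 5≤k = record { graph = graph ; connected = connected 5≤k }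
  where open Construction k

{-# OPTIONS --safe #-}

-- A connected subgraph with n vertices has at least n − 1 edges, so everything
-- reduces to counting the extra vertices needed to connect S.
--
-- Upper bounds.  Attaching each d_j to one chosen a or b, and those to r, gives a
-- tree of depth two.  Together with r, the vertices a_m, b_m and a_1 reach all of D,
-- so d(S) ≤ k + 3.  If some d_i ∉ S, then a_i and b_m (or a_m and b_i) suffice, and if
-- r ∈ S such an i exists, because then |S ∩ D| < k; hence e_k(r) ≤ k + 1.
--
-- Lower bounds.  Reaching every d_j with j < m, and connecting these to something
-- else, takes two a's or the pair a_m, r: an a_i with i < m misses d_i, and the only
-- neighbour of a_m outside {d_1, …, d_(m−1)} is r.  Likewise on the other side.  As d_m
-- is adjacent to neither a_m nor b_m, D needs four extra vertices.  Each of the sets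
-- {a_i} ∪ D ∖ {d_i}, {b_i} ∪ D ∖ {d_i} and {r} ∪ D ∖ {d_m} needs two, which gives
-- e_k(v) ≥ k + 1 for every v.
module Submission where

open import Defs
open import Data.Nat using (ℕ; _+_; _≤_)
open import Data.Product using (_×_)
open import Data.Fin using (toℕ; fromℕ<)
open import Data.Fin.Properties using (toℕ<n; toℕ-fromℕ<; toℕ-injective)
open import Data.Irrelevant using ([_])
open import Data.List using (List; []; _∷_; _++_; length; map; filter; tabulate; deduplicate)
open import Data.List.Membership.Propositional using (_∈_; _∉_; find)
open import Data.List.Membership.Propositional.Properties
  using (∈-filter⁺; ∈-filter⁻; ∈-map⁺; ∈-map⁻; ∈-tabulate⁺; ∈-tabulate⁻;
         ∈-deduplicate⁺; ∈-deduplicate⁻)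
open import Data.List.Properties
  using (filter-all; filter-notAll; length-map; length-tabulate; length-deduplicate; length-++)
open import Data.List.Relation.Binary.Subset.Propositional using (_⊆_)
open import Data.List.Relation.Unary.All as All using (All; []; _∷_)
open import Data.List.Relation.Unary.All.Properties using (¬All⇒Any¬)
open import Data.List.Relation.Unary.AllPairs using (AllPairs; []; _∷_)
import Data.List.Relation.Unary.AllPairs.Properties as AllPairs
open import Data.List.Relation.Unary.Any as Any using (here; there)
open import Data.List.Relation.Unary.Any.Properties using (++⁻)
open import Data.List.Relation.Unary.Unique.Propositional using (Unique)
open import Data.List.Relation.Unary.Unique.Propositional.Properties using (++⁺; filter⁺; tabulate⁺)
import Data.List.Membership.DecPropositional as DecMembership
import Data.List.Relation.Unary.Unique.DecPropositional.Properties as DecUnique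
open import Data.Nat using (zero; suc; _<_; z≤n; s≤s; ⌈_/2⌉)
  renaming (_≟_ to _≟ℕ_; _≤?_ to _≤?ℕ_)
open import Data.Nat.Properties
  using (≤-refl; ≤-reflexive; ≤-trans; ≤-antisym; ≤-pred; ≤-total; <⇒≤; <⇒≢; >⇒≢; ≰⇒>; <-irrefl;
         <-≤-trans; suc-injective; +-comm; +-suc; +-monoʳ-≤; m≤n+m; <-cmp; ⌊n/2⌋<n; ⌈n/2⌉-mono;
         module ≤-Reasoning)
open import Data.Product using (∃-syntax; _,_; proj₁; proj₂; swap)
import Data.Product as Product
open import Data.Refinement using (value; value-injective; _,_)
open import Data.Sum using (_⊎_; inj₁; inj₂; [_,_]′)
open import Function using (_∘_; id)
open import Level using (0ℓ)
open import Relation.Binary using (Rel; DecidableEquality; tri<; tri≈; tri>)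
open import Relation.Binary.Construct.Closure.Equivalence as Eq using (EqClosure)
open import Relation.Binary.Construct.Closure.ReflexiveTransitive using (ε; _◅_; _◅◅_)
open import Relation.Binary.Construct.Closure.Symmetric using (SymClosure; fwd; bwd)
open import Relation.Binary.PropositionalEquality
  using (_≡_; _≢_; refl; sym; trans; cong; subst; subst₂; ≢-sym)
open import Relation.Nullary using (¬_; yes; no; contradiction)
open import Relation.Nullary.Decidable using (map′; ¬?; _×-dec_)
open import Relation.Unary using (Decidable)

-- Vertex removal and edge contraction in lists with decidable equality.

module DecList {A : Set} (_≟_ : DecidableEquality A) where

  infixl 5 _∖_
  _∖_ : List A → A → List A
  xs ∖ x = filter (λ y → ¬? (y ≟ x)) xs

  ∈-∖⁺ : ∀ {xs x y} → y ∈ xs → y ≢ x → y ∈ xs ∖ x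
  ∈-∖⁺ = ∈-filter⁺ (λ y → ¬? (y ≟ _))

  ∈-∖⁻ : ∀ {xs x y} → y ∈ xs ∖ x → y ∈ xs × y ≢ x
  ∈-∖⁻ {xs} = ∈-filter⁻ (λ y → ¬? (y ≟ _)) {xs = xs}

  Unique-∖ : ∀ {xs} x → Unique xs → Unique (xs ∖ x)
  Unique-∖ x = filter⁺ (λ y → ¬? (y ≟ x))

  length-∖-≤ : ∀ {xs} x → Unique xs → length xs ≤ suc (length (xs ∖ x))
  length-∖-≤ x [] = z≤n
  length-∖-≤ {y ∷ xs} x (y∉xs ∷ u) with y ≟ x
  ... | no _     = s≤s (length-∖-≤ x u)
  ... | yes refl =
    s≤s (≤-reflexive (cong length (sym (filter-all (λ z → ¬? (z ≟ x)) (All.map ≢-sym y∉xs)))))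

  length-∖-< : ∀ {xs x} → x ∈ xs → length (xs ∖ x) < length xs
  length-∖-< {xs} x∈xs = filter-notAll _ xs (Any.map (λ x≡y y≢x → y≢x (sym x≡y)) x∈xs)

  Unique-⊆⇒length-≤ : ∀ {xs ys} → Unique xs → xs ⊆ ys → length xs ≤ length ys
  Unique-⊆⇒length-≤ [] _ = z≤n
  Unique-⊆⇒length-≤ (x∉xs ∷ u) xs⊆ys = ≤-trans
    (s≤s (Unique-⊆⇒length-≤ u λ z∈xs → ∈-∖⁺ (xs⊆ys (there z∈xs)) (≢-sym (All.lookup x∉xs z∈xs))))
    (length-∖-< (xs⊆ys (here refl)))

  Joined : List (A × A) → Rel A 0ℓ
  Joined es = EqClosure λ u v → (u , v) ∈ es

  merge : A → A → A → A
  merge x y z with z ≟ y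
  ... | yes _ = x
  ... | no  _ = z

  merge-target : ∀ x y → merge x y y ≡ x
  merge-target x y with y ≟ y
  ... | yes _   = refl
  ... | no  y≢y = contradiction refl y≢y

  merge-other : ∀ x {y z} → z ≢ y → merge x y z ≡ z
  merge-other x {y} {z} z≢y with z ≟ y
  ... | yes z≡y = contradiction z≡y z≢y
  ... | no  _   = refl

  merge-source : ∀ x y → merge x y x ≡ x
  merge-source x y with x ≟ y
  ... | yes _ = refl
  ... | no  _ = refl

  -- A path is carried along `merge x y` step by step; a step over the contracted edge becomes
  -- trivial, because both of its ends go to `x`.
  Joined-contract : ∀ {x y es u v} → Joined ((x , y) ∷ es) u v →
                    Joined (map (Product.map (merge x y) (merge x y)) es)
                           (merge x y u) (merge x y v)
  Joined-contract {x} {y} {es} = Eq.gfold (Eq.isEquivalence _) (merge x y) λ where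
    (here refl) → subst (Joined _ _) (trans (merge-source x y) (sym (merge-target x y))) ε
    (there e∈)  → Eq.return (∈-map⁺ (Product.map (merge x y) (merge x y)) e∈)

  -- Contracting an edge xy loses one edge and, by deleting y, at most one vertex.
  Joined⇒length-≤ : ∀ {xs} es → Unique xs → (∀ {u v} → u ∈ xs → v ∈ xs → Joined es u v) →
                    length xs ≤ suc (length es)
  Joined⇒length-≤ es = bound (length es) es refl
    where
    -- The induction runs on the number of edges, since contraction rewrites the remaining list and
    -- so leaves no structural descent on `es`.
    bound : ∀ n {xs} es → length es ≡ n → Unique xs →
            (∀ {u v} → u ∈ xs → v ∈ xs → Joined es u v) → length xs ≤ suc n
    bound zero [] _ [] _ = z≤n
    bound zero [] _ (_ ∷ []) _ = s≤s z≤n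
    bound zero [] _ ((x≢y ∷ _) ∷ _ ∷ _) joined with joined (here refl) (there (here refl))
    ... | ε          = contradiction refl x≢y
    ... | fwd () ◅ _
    ... | bwd () ◅ _
    bound (suc n) {xs} ((x , y) ∷ es) eq u joined = ≤-trans (length-∖-≤ y u)
      (s≤s (bound n _ (trans (length-map _ es) (suc-injective eq)) (Unique-∖ y u) joined∖))
      where
      joined∖ : ∀ {v w} → v ∈ xs ∖ y → w ∈ xs ∖ y → Joined _ v w
      joined∖ v∈ w∈ with ∈-∖⁻ {xs} v∈ | ∈-∖⁻ {xs} w∈
      ... | v∈xs , v≢y | w∈xs , w≢y =
        subst₂ (Joined _) (merge-other x v≢y) (merge-other x w≢y)
          (Joined-contract (joined v∈xs w∈xs))

-- Connected subgraphs: vertex counting, boundary crossings and trees of depth two.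

module DecGraph (G : Graph) (_≟_ : DecidableEquality (Graph.Vertex G)) where
  open Graph G
  open Subgraph
  open DecList _≟_

  module _ (H : Subgraph G) (conn : IsConnected H) where

    Unique⇒length≤1+size : ∀ {xs} → Unique xs → xs ⊆ verts H → length xs ≤ suc (size H)
    Unique⇒length≤1+size u xs⊆ = Joined⇒length-≤ (edges H) u λ v∈ w∈ → conn (xs⊆ v∈) (xs⊆ w∈)

    -- The path in `H` from `u` to `v` is followed up to its first step out of `P`.
    crossing : ∀ {P : Vertex → Set} → Decidable P → ∀ {u v} → u ∈ verts H → v ∈ verts H →
               P u → ¬ P v → ∃[ x ] ∃[ y ] P x × ¬ P y × x ~ y × y ∈ verts H
    crossing {P} P? u∈ v∈ = along (conn u∈ v∈)
      where
      link : ∀ {x y} → SymClosure (λ u v → (u , v) ∈ edges H) x y → x ~ y × y ∈ verts H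
      link (fwd e) = adjacent H e , proj₂ (endpoints H e)
      link (bwd e) = ~-sym (adjacent H e) , proj₁ (endpoints H e)

      along : ∀ {u v} → Joined (edges H) u v → P u → ¬ P v →
              ∃[ x ] ∃[ y ] P x × ¬ P y × x ~ y × y ∈ verts H
      along ε pu ¬pv = contradiction pu ¬pv
      along (_◅_ {j = w} s path) pu ¬pv with P? w
      ... | yes pw = along path pw ¬pv
      ... | no ¬pw = _ , _ , pu , ¬pw , link s

    neighbour : ∀ {u v} → u ∈ verts H → v ∈ verts H → u ≢ v → ∃[ w ] u ~ w × w ∈ verts H
    neighbour {u} u∈ v∈ u≢v with crossing (_≟ u) u∈ v∈ refl (≢-sym u≢v)
    ... | _ , w , refl , _ , u~w , w∈ = w , u~w , w∈

  -- An upper bound on the Steiner distance. The inequality spares computing the exact size of a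
  -- tree whose vertex list may contain repetitions.
  Covers : List Vertex → ℕ → Set
  Covers S x = ∃[ H ] IsConnected {G} H × S ⊆ verts H × size H ≤ x

  -- The edges joining each vertex to its parent form a tree of depth two.
  parent-tree : ∀ {T} root (parent : Vertex → Vertex) → root ∈ T → parent root ≡ root →
                (∀ {v} → v ∈ T → v ≢ root →
                  parent v ∈ T × v ~ parent v × parent (parent v) ≡ root) →
                ∃[ H ] IsConnected {G} H × T ⊆ verts H × size H < length T
  parent-tree {T} root parent root∈T parent-root step = H , conn , T⊆ , size<
    where
    xs : List Vertex
    -- `T` is typically a set `S` with helper vertices put in front, and these may already lie in
    -- `S`. Dropping repetitions only lowers the number of edges.
    xs = deduplicate _≟_ (T ∖ root)

    ∈-xs⁺ : ∀ {v} → v ∈ T → v ≢ root → v ∈ xs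
    ∈-xs⁺ v∈ v≢ = ∈-deduplicate⁺ _≟_ (∈-∖⁺ v∈ v≢)

    ∈-xs⁻ : ∀ {v} → v ∈ xs → v ∈ T × v ≢ root
    ∈-xs⁻ v∈ = ∈-∖⁻ {T} (∈-deduplicate⁻ _≟_ (T ∖ root) v∈)

    T⊆ : T ⊆ root ∷ xs
    T⊆ {v} v∈ with v ≟ root
    ... | yes v≡ = here v≡
    ... | no  v≢ = there (∈-xs⁺ v∈ v≢)

    edge : Vertex → Vertex × Vertex
    edge v = v , parent v

    -- If the edge of `v` reversed were the edge of `w`, then `w` would be the parent of `v` and `v`
    -- the parent of `w`, making `v` its own grandparent.
    distinct-edges : ∀ {ys} → Unique ys → All (λ v → parent (parent v) ≢ v) ys →
                     AllPairs (λ v w → edge v ≢ edge w × swap (edge v) ≢ edge w) ys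
    distinct-edges [] [] = []
    distinct-edges (v∉ ∷ u) (q ∷ qs) = All.map
      (λ v≢w → (λ e → v≢w (cong proj₁ e)) ,
               (λ e → q (trans (cong (parent ∘ proj₁) e) (sym (cong proj₂ e)))))
      v∉ ∷ distinct-edges u qs

    H : Subgraph G
    H = record
      { verts     = root ∷ xs
      ; edges     = map edge xs
      ; distinct  = AllPairs.map⁺ (distinct-edges (DecUnique.deduplicate-! _≟_ (T ∖ root))
          (All.tabulate λ v∈ ppv≡v → let v∈T , v≢ = ∈-xs⁻ v∈ in
            v≢ (trans (sym ppv≡v) (proj₂ (proj₂ (step v∈T v≢))))))
      ; adjacent  = λ e∈ → adj (∈-map⁻ edge e∈)
      ; endpoints = λ e∈ → ends (∈-map⁻ edge e∈)
      }
      where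
      adj : ∀ {u v} → ∃[ w ] w ∈ xs × (u , v) ≡ edge w → u ~ v
      adj (w , w∈ , refl) = let w∈T , w≢ = ∈-xs⁻ w∈ in proj₁ (proj₂ (step w∈T w≢))

      ends : ∀ {u v} → ∃[ w ] w ∈ xs × (u , v) ≡ edge w → u ∈ root ∷ xs × v ∈ root ∷ xs
      ends (w , w∈ , refl) = let w∈T , w≢ = ∈-xs⁻ w∈ in there w∈ , T⊆ (proj₁ (step w∈T w≢))

    ascend : ∀ {v} → v ∈ root ∷ xs → Joined (edges H) v (parent v)
    ascend (here refl) = subst (Joined _ root) (sym parent-root) ε
    ascend (there v∈)  = Eq.return (∈-map⁺ edge v∈)

    to-root : ∀ {v} → v ∈ root ∷ xs → Joined (edges H) v root
    to-root (here refl) = ε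
    to-root (there v∈) with ∈-xs⁻ v∈
    ... | v∈T , v≢ with step v∈T v≢
    ...   | pv∈ , _ , ppv≡root = ascend (there v∈) ◅◅ subst (Joined _ _) ppv≡root (ascend (T⊆ pv∈))

    conn : IsConnected H
    conn u∈ v∈ = to-root u∈ ◅◅ Eq.symmetric _ (to-root v∈)

    size< : size H < length T
    size< = begin-strict
      length (map edge xs)  ≡⟨ length-map edge xs ⟩
      length xs             ≤⟨ length-deduplicate _≟_ (T ∖ root) ⟩
      length (T ∖ root)     <⟨ length-∖-< root∈T ⟩
      length T              ∎
      where open ≤-Reasoning

-- Vertices and indices of the graph.

module Proof (k : ℕ) (5≤k : 5 ≤ k) where
  open Construction k
  open Graph graph using (_~_)
  open Subgraph

  d-injective : ∀ {i j} → V.d i ≡ d j → i ≡ j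
  d-injective refl = refl

  infix 4 _≟_
  _≟_ : DecidableEquality V
  d i ≟ d j = map′ (cong d ∘ value-injective) (λ { refl → refl }) (value i ≟ℕ value j)
  a i ≟ a j = map′ (cong a ∘ value-injective) (λ { refl → refl }) (value i ≟ℕ value j)
  b i ≟ b j = map′ (cong b ∘ value-injective) (λ { refl → refl }) (value i ≟ℕ value j)
  r   ≟ r   = yes refl
  d _ ≟ a _ = no λ ()
  d _ ≟ b _ = no λ ()
  d _ ≟ r   = no λ ()
  a _ ≟ d _ = no λ ()
  a _ ≟ b _ = no λ ()
  a _ ≟ r   = no λ ()
  b _ ≟ d _ = no λ ()
  b _ ≟ a _ = no λ ()
  b _ ≟ r   = no λ ()
  r   ≟ d _ = no λ ()
  r   ≟ a _ = no λ ()
  r   ≟ b _ = no λ ()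

  open DecList _≟_
  open DecGraph graph _≟_
  open DecMembership _≟_ using (_∈?_)

  1<m : 1 < m
  1<m = ≤-trans (s≤s (s≤s z≤n)) (⌈n/2⌉-mono (s≤s 5≤k))

  m<k : m < k
  m<k = half 5≤k
    where
    half : ∀ {k} → 5 ≤ k → ⌈ suc k /2⌉ < k
    half (s≤s (s≤s (s≤s _))) = s≤s (s≤s (⌊n/2⌋<n _))

  d-first d-mid d-last : Range 1 k
  d-first = 1 , [ ≤-refl , <⇒≤ (<-≤-trans 1<m (<⇒≤ m<k)) ]
  d-mid   = m , [ <⇒≤ 1<m , <⇒≤ m<k ]
  d-last  = k , [ <⇒≤ (<-≤-trans 1<m (<⇒≤ m<k)) , ≤-refl ]

  a-first a-mid : Range 1 m
  a-first = 1 , [ ≤-refl , <⇒≤ 1<m ]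
  a-mid   = m , [ <⇒≤ 1<m , ≤-refl ]

  b-mid : Range m k
  b-mid = m , [ ≤-refl , <⇒≤ m<k ]

  d-of-a : Range 1 m → Range 1 k
  d-of-a i = value i , [ proj₁ (bounds i) , ≤-trans (proj₂ (bounds i)) (<⇒≤ m<k) ]

  d-of-b : Range m k → Range 1 k
  d-of-b i = value i , [ ≤-trans (<⇒≤ 1<m) (proj₁ (bounds i)) , proj₂ (bounds i) ]

  D : List V
  D = tabulate {n = k} λ i → d (suc (toℕ i) , [ s≤s z≤n , toℕ<n i ])

  length-D : length D ≡ k
  length-D = length-tabulate _

  Unique-D : Unique D
  Unique-D = tabulate⁺ λ e → toℕ-injective (suc-injective (cong value (d-injective e)))

  ∈-D⁺ : ∀ j → d j ∈ D
  ∈-D⁺ (zero , p) = contradiction (proj₁ (bounds {1} {k} (zero , p))) λ ()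
  ∈-D⁺ (suc j , p) = subst (_∈ D) (cong d (value-injective (cong suc (toℕ-fromℕ< _))))
    (∈-tabulate⁺ (fromℕ< (proj₂ (bounds {1} {k} (suc j , p)))))

  ∈-D⁻ : ∀ {v} → v ∈ D → ∃[ j ] v ≡ d j
  ∈-D⁻ v∈ = let _ , v≡ = ∈-tabulate⁻ v∈ in _ , v≡

  -- The vertices a, b and r. In this negative form each instance is an absurd match.
  Aux : V → Set
  Aux v = ∀ j → v ≢ d j

  Aux⇒∉D : ∀ {v} → Aux v → v ∉ D
  Aux⇒∉D aux v∈D with ∈-D⁻ v∈D
  ... | _ , v≡d = aux _ v≡d

  length-∷-D∖ : ∀ v i → length (v ∷ (D ∖ d i)) ≡ k
  length-∷-D∖ v i = ≤-antisym
    (≤-trans (length-∖-< (∈-D⁺ i)) (≤-reflexive length-D))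
    (≤-trans (≤-reflexive (sym length-D)) (length-∖-≤ (d i) Unique-D))

  Unique-∷-D∖ : ∀ {v} i → Aux v → Unique (v ∷ (D ∖ d i))
  Unique-∷-D∖ i aux =
    All.tabulate (λ w∈ → λ { refl → Aux⇒∉D aux (proj₁ (∈-∖⁻ {D} w∈)) }) ∷ Unique-∖ (d i) Unique-D

  -- Lower bounds on the size of connected subgraphs.

  module _ (H : Subgraph graph) (conn : IsConnected H) where

    Aux-bound : ∀ {xs ds} → Unique xs → All Aux xs → Unique ds → ds ⊆ D →
                xs ⊆ verts H → ds ⊆ verts H → length xs + length ds ≤ suc (size H)
    Aux-bound {xs} {ds} uxs aux uds ds⊆D xs⊆ ds⊆ = ≤-trans
      (≤-reflexive (sym (length-++ xs)))
      (Unique⇒length≤1+size H conn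
        (++⁺ uxs uds λ (v∈xs , v∈ds) → Aux⇒∉D (All.lookup aux v∈xs) (ds⊆D v∈ds))
        ([ xs⊆ , ds⊆ ]′ ∘ ++⁻ xs))

    Aux-bound-D∖ : ∀ {xs} i → Unique xs → All Aux xs → xs ⊆ verts H → D ∖ d i ⊆ verts H →
                   length xs + k ≤ suc (suc (size H))
    Aux-bound-D∖ {xs} i uxs aux xs⊆ ds⊆ = begin
      length xs + k                        ≡⟨ cong (length xs +_) (sym length-D) ⟩
      length xs + length D                 ≤⟨ +-monoʳ-≤ (length xs) (length-∖-≤ (d i) Unique-D) ⟩
      length xs + suc (length (D ∖ d i))   ≡⟨ +-suc (length xs) _ ⟩
      suc (length xs + length (D ∖ d i))   ≤⟨ s≤s (Aux-bound uxs aux (Unique-∖ (d i) Unique-D)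
                                                (λ v∈ → proj₁ (∈-∖⁻ {D} v∈)) xs⊆ ds⊆) ⟩
      suc (suc (size H))                   ∎
      where open ≤-Reasoning

  -- With bounds 1, m these are the indices of D₁ without d_m; with bounds m, k, those of D₂ without
  -- d_m.
  Wing : ℕ → ℕ → Range 1 k → Set
  Wing lo hi j = lo ≤ value j × value j ≤ hi × value j ≢ m

  -- Passes from a vertex c_i to d_i, whose indices live in different range types.
  Index : ℕ → Set
  Index n = ∃[ j ] value {P = λ i → 1 ≤ i × i ≤ k} j ≡ n

  -- The argument common to both halves of the graph: `c` is `a` with bounds 1, m or `b` with bounds
  -- m, k.
  module Side {lo hi : ℕ} (c : Range lo hi → V) (mid : Range lo hi) (value-mid : value mid ≡ m)
    (d-nbr : ∀ j {v} → Wing lo hi j → d j ~ v → ∃[ i ] v ≡ c i × value i ≢ value j)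
    (c-nbr : ∀ {i : Range lo hi} {v} → c i ~ v →
             v ≡ r ⊎ (∃[ j ] v ≡ d j × lo ≤ value j × value j ≤ hi × value j ≢ value i))
    (d-of-c : (i : Range lo hi) → Index (value i))
    where

    -- Chosen so that an edge can leave this set only towards `r` or towards some c_l other than
    -- `c mid`, each of which completes a pair.
    Near : V → Set
    Near v = v ≡ c mid ⊎ (∃[ j ] v ≡ d j × Wing lo hi j)

    near? : Decidable Near
    near? v with v ≟ c mid
    near? v     | yes v≡ = yes (inj₁ v≡)
    near? (a _) | no  v≢ = no λ { (inj₁ v≡) → v≢ v≡ }
    near? (b _) | no  v≢ = no λ { (inj₁ v≡) → v≢ v≡ }
    near? r     | no  v≢ = no λ { (inj₁ v≡) → v≢ v≡ }
    near? (d j) | no  v≢ = map′ (λ w → inj₂ (j , refl , w))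
      (λ { (inj₁ v≡) → contradiction v≡ v≢ ; (inj₂ (_ , refl , w)) → w })
      ((lo ≤?ℕ value j) ×-dec (value j ≤?ℕ hi) ×-dec ¬? (value j ≟ℕ m))

    Pair : Subgraph graph → Set
    Pair H = (∃[ i ] ∃[ j ] c i ∈ verts H × c j ∈ verts H × value i ≢ value j)
           ⊎ (c mid ∈ verts H × r ∈ verts H)

    -- If only c mid is used, an edge of H leaves c mid and the d's attached to it.
    pair : ∀ H {z} e → IsConnected H → (∀ j → Wing lo hi j → d j ∈ verts H) →
           Wing lo hi e → z ∈ verts H → ¬ Near z → Pair H
    pair H e conn wing⊆ we z∈ ¬near-z = pair′ (attached e we)
      where
      -- As `z` is not near, it differs from d_j, so d_j has a neighbour in `H`; in the wing, such a
      -- neighbour is some c_i with i ≠ j.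
      attached : ∀ j → Wing lo hi j → ∃[ i ] c i ∈ verts H × value i ≢ value j
      attached j wj
        with neighbour H conn (wing⊆ j wj) z∈ (λ dj≡z → ¬near-z (inj₂ (j , sym dj≡z , wj)))
      ... | _ , j~ , ci∈ with d-nbr j wj j~
      ... | i , refl , i≢j = i , ci∈ , i≢j

      exit : c mid ∈ verts H → ∃[ x ] ∃[ y ] Near x × ¬ Near y × x ~ y × y ∈ verts H → Pair H
      exit mid∈ (_ , y , inj₁ refl , ¬near-y , x~y , y∈) with c-nbr x~y
      ... | inj₁ refl = inj₂ (mid∈ , y∈)
      ... | inj₂ (j , refl , lo≤ , ≤hi , j≢) =
        -- A neighbour d_j of `c mid` has j ≠ m, so it belongs to the wing and the edge has not left
        -- `Near`.
        contradiction (inj₂ (j , refl , lo≤ , ≤hi , λ j≡m → j≢ (trans j≡m (sym value-mid)))) ¬near-y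
      exit mid∈ (_ , y , inj₂ (j , refl , wj) , ¬near-y , x~y , y∈) with d-nbr j wj x~y
      ... | l , refl , _ = inj₁ (mid , l , mid∈ , y∈ ,
        λ mid≡l → ¬near-y (inj₁ (cong c (sym (value-injective mid≡l)))))

      pair′ : ∃[ i ] c i ∈ verts H × value i ≢ value e → Pair H
      pair′ (i , ci∈ , _) with value i ≟ℕ m | d-of-c i
      ... | yes i≡m | _ = exit mid∈ (crossing H conn near? mid∈ z∈ (inj₁ refl) ¬near-z)
        where
        mid∈ : c mid ∈ verts H
        mid∈ = subst (λ i → c i ∈ verts H) (value-injective (trans i≡m (sym value-mid))) ci∈
      -- For i ≠ m the vertex d_i is itself in the wing, and c_i is not adjacent to it; whatever
      -- attaches d_i is the second vertex.
      ... | no i≢m | j , refl with attached j (proj₁ (bounds i) , proj₂ (bounds i) , i≢m)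
      ...   | l , cl∈ , l≢i = inj₁ (i , l , ci∈ , cl∈ , ≢-sym l≢i)

  a-wing-neighbour : ∀ j {v} → Wing 1 m j → d j ~ v → ∃[ i ] v ≡ a i × value i ≢ value j
  a-wing-neighbour _ _               (bwd (a-d _ j≢i)) = _ , refl , ≢-sym j≢i
  a-wing-neighbour _ (_ , j≤m , j≢m) (bwd (b-d m≤j _)) = contradiction (≤-antisym j≤m m≤j) j≢m

  b-wing-neighbour : ∀ j {v} → Wing m k j → d j ~ v → ∃[ i ] v ≡ b i × value i ≢ value j
  b-wing-neighbour _ _               (bwd (b-d _ j≢i)) = _ , refl , ≢-sym j≢i
  b-wing-neighbour _ (m≤j , _ , j≢m) (bwd (a-d j≤m _)) = contradiction (≤-antisym j≤m m≤j) j≢m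

  a-neighbour : ∀ {i v} → a i ~ v →
                v ≡ r ⊎ (∃[ j ] v ≡ d j × 1 ≤ value j × value j ≤ m × value j ≢ value i)
  a-neighbour (fwd (a-d {j = j} j≤m j≢i)) = inj₂ (j , refl , proj₁ (bounds j) , j≤m , j≢i)
  a-neighbour (bwd r-a)                   = inj₁ refl

  b-neighbour : ∀ {i v} → b i ~ v →
                v ≡ r ⊎ (∃[ j ] v ≡ d j × m ≤ value j × value j ≤ k × value j ≢ value i)
  b-neighbour (fwd (b-d {j = j} m≤j j≢i)) = inj₂ (j , refl , m≤j , proj₂ (bounds j) , j≢i)
  b-neighbour (bwd r-b)                   = inj₁ refl

  module A-side = Side a a-mid refl a-wing-neighbour a-neighbour (λ i → d-of-a i , refl)
  module B-side = Side b b-mid refl b-wing-neighbour b-neighbour (λ i → d-of-b i , refl)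

  module _ (H : Subgraph graph) (conn : IsConnected H) where

    D-lower : (∀ j → d j ∈ verts H) → 3 + k ≤ size H
    D-lower D⊆ = four
      -- The far ends d_k and d_1 serve as the vertices outside `Near`: 1 < m < k puts each in the
      -- opposite wing.
      (A-side.pair H d-first conn (λ j _ → D⊆ j) (≤-refl , <⇒≤ 1<m , <⇒≢ 1<m) (D⊆ d-last)
        λ { (inj₁ ()) ; (inj₂ (_ , refl , _ , k≤m , _)) → <-irrefl refl (<-≤-trans m<k k≤m) })
      (B-side.pair H d-last conn (λ j _ → D⊆ j) (<⇒≤ m<k , ≤-refl , >⇒≢ m<k) (D⊆ d-first)
        λ { (inj₁ ()) ; (inj₂ (_ , refl , m≤1 , _)) → <-irrefl refl (<-≤-trans 1<m m≤1) })
      where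
      count : ∀ {x y z w} → Unique (x ∷ y ∷ z ∷ w ∷ []) → All Aux (x ∷ y ∷ z ∷ w ∷ []) →
              All (_∈ verts H) (x ∷ y ∷ z ∷ w ∷ []) → 3 + k ≤ size H
      count {x} {y} {z} {w} u aux xs∈ = ≤-pred (subst (λ n → 4 + n ≤ suc (size H)) length-D
        (Aux-bound H conn {xs = x ∷ y ∷ z ∷ w ∷ []} u aux Unique-D id (All.lookup xs∈)
          (λ v∈ → subst (_∈ verts H) (sym (proj₂ (∈-D⁻ v∈))) (D⊆ _))))

      four : A-side.Pair H → B-side.Pair H → 3 + k ≤ size H
      four (inj₁ (i , j , ai∈ , aj∈ , i≢j)) (inj₁ (i′ , j′ , bi∈ , bj∈ , i′≢j′)) = count
        (((λ { refl → i≢j refl }) ∷ (λ ()) ∷ (λ ()) ∷ []) ∷ ((λ ()) ∷ (λ ()) ∷ [])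
          ∷ ((λ { refl → i′≢j′ refl }) ∷ []) ∷ [] ∷ [])
        ((λ _ ()) ∷ (λ _ ()) ∷ (λ _ ()) ∷ (λ _ ()) ∷ [])
        (ai∈ ∷ aj∈ ∷ bi∈ ∷ bj∈ ∷ [])
      four (inj₁ (i , j , ai∈ , aj∈ , i≢j)) (inj₂ (bm∈ , r∈)) = count
        (((λ { refl → i≢j refl }) ∷ (λ ()) ∷ (λ ()) ∷ []) ∷ ((λ ()) ∷ (λ ()) ∷ [])
          ∷ ((λ ()) ∷ []) ∷ [] ∷ [])
        ((λ _ ()) ∷ (λ _ ()) ∷ (λ _ ()) ∷ (λ _ ()) ∷ [])
        (ai∈ ∷ aj∈ ∷ bm∈ ∷ r∈ ∷ [])
      four (inj₂ (am∈ , r∈)) (inj₁ (i , j , bi∈ , bj∈ , i≢j)) = count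
        (((λ { refl → i≢j refl }) ∷ (λ ()) ∷ (λ ()) ∷ []) ∷ ((λ ()) ∷ (λ ()) ∷ [])
          ∷ ((λ ()) ∷ []) ∷ [] ∷ [])
        ((λ _ ()) ∷ (λ _ ()) ∷ (λ _ ()) ∷ (λ _ ()) ∷ [])
        (bi∈ ∷ bj∈ ∷ am∈ ∷ r∈ ∷ [])
      -- Both pairs share `r`, so they supply only three vertices. The fourth is a neighbour of d_m
      -- in `H`, which is some a_i or b_i with i ≠ m.
      four (inj₂ (am∈ , r∈)) (inj₂ (bm∈ , _))
        with neighbour H conn (D⊆ d-mid) r∈ (λ ())
      ... | _ , bwd (a-d _ m≢i) , ai∈ = count
        (((λ { refl → m≢i refl }) ∷ (λ ()) ∷ (λ ()) ∷ []) ∷ ((λ ()) ∷ (λ ()) ∷ [])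
          ∷ ((λ ()) ∷ []) ∷ [] ∷ [])
        ((λ _ ()) ∷ (λ _ ()) ∷ (λ _ ()) ∷ (λ _ ()) ∷ [])
        (ai∈ ∷ am∈ ∷ bm∈ ∷ r∈ ∷ [])
      ... | _ , bwd (b-d _ m≢i) , bi∈ = count
        (((λ { refl → m≢i refl }) ∷ (λ ()) ∷ (λ ()) ∷ []) ∷ ((λ ()) ∷ (λ ()) ∷ [])
          ∷ ((λ ()) ∷ []) ∷ [] ∷ [])
        ((λ _ ()) ∷ (λ _ ()) ∷ (λ _ ()) ∷ (λ _ ()) ∷ [])
        (bi∈ ∷ bm∈ ∷ am∈ ∷ r∈ ∷ [])

    -- Here `x` replaces the missing d_i in the count, so `y` and `z` are the two extra vertices: k
    -- + 2 vertices need k + 1 edges.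
    D∖-lower : ∀ {x y z} i → Unique (x ∷ y ∷ z ∷ []) → All Aux (x ∷ y ∷ z ∷ []) →
               y ∈ verts H → z ∈ verts H → x ∷ (D ∖ d i) ⊆ verts H → suc k ≤ size H
    D∖-lower {x} {y} {z} i u aux y∈ z∈ S⊆ = ≤-pred (≤-pred
      (Aux-bound-D∖ H conn {xs = x ∷ y ∷ z ∷ []} i u aux
        (All.lookup (S⊆ (here refl) ∷ y∈ ∷ z∈ ∷ [])) (S⊆ ∘ there)))

    -- Since i ≤ m, deleting d_i leaves the wing of the b side intact, and a_i lies outside `Near`
    -- on that side; the pair found there gives the two extra vertices.
    a-lower : ∀ i → a i ∷ (D ∖ d (d-of-a i)) ⊆ verts H → suc k ≤ size H
    a-lower i S⊆ = three (B-side.pair H d-last conn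
      (λ j (m≤j , _ , j≢m) → S⊆ (there (∈-∖⁺ (∈-D⁺ j)
        λ { refl → j≢m (≤-antisym (proj₂ (bounds i)) m≤j) })))
      (<⇒≤ m<k , ≤-refl , >⇒≢ m<k) (S⊆ (here refl)) (λ { (inj₁ ()) ; (inj₂ (_ , () , _)) }))
      where
      three : B-side.Pair H → suc k ≤ size H
      three (inj₁ (_ , _ , y∈ , z∈ , ne)) = D∖-lower (d-of-a i)
        (((λ ()) ∷ (λ ()) ∷ []) ∷ ((λ { refl → ne refl }) ∷ []) ∷ [] ∷ [])
        ((λ _ ()) ∷ (λ _ ()) ∷ (λ _ ()) ∷ []) y∈ z∈ S⊆
      three (inj₂ (y∈ , z∈)) = D∖-lower (d-of-a i)
        (((λ ()) ∷ (λ ()) ∷ []) ∷ ((λ ()) ∷ []) ∷ [] ∷ [])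
        ((λ _ ()) ∷ (λ _ ()) ∷ (λ _ ()) ∷ []) y∈ z∈ S⊆

    b-lower : ∀ i → b i ∷ (D ∖ d (d-of-b i)) ⊆ verts H → suc k ≤ size H
    b-lower i S⊆ = three (A-side.pair H d-first conn
      (λ j (_ , j≤m , j≢m) → S⊆ (there (∈-∖⁺ (∈-D⁺ j)
        λ { refl → j≢m (≤-antisym j≤m (proj₁ (bounds i))) })))
      (≤-refl , <⇒≤ 1<m , <⇒≢ 1<m) (S⊆ (here refl)) (λ { (inj₁ ()) ; (inj₂ (_ , () , _)) }))
      where
      three : A-side.Pair H → suc k ≤ size H
      three (inj₁ (_ , _ , y∈ , z∈ , ne)) = D∖-lower (d-of-b i)
        (((λ ()) ∷ (λ ()) ∷ []) ∷ ((λ { refl → ne refl }) ∷ []) ∷ [] ∷ [])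
        ((λ _ ()) ∷ (λ _ ()) ∷ (λ _ ()) ∷ []) y∈ z∈ S⊆
      three (inj₂ (y∈ , z∈)) = D∖-lower (d-of-b i)
        (((λ ()) ∷ (λ ()) ∷ []) ∷ ((λ ()) ∷ []) ∷ [] ∷ [])
        ((λ _ ()) ∷ (λ _ ()) ∷ (λ _ ()) ∷ []) y∈ z∈ S⊆

    -- Every neighbour of d_1 is an a and every neighbour of d_k is a b, so one of each must occur
    -- in `H` besides the given set.
    r-lower : r ∷ (D ∖ d d-mid) ⊆ verts H → suc k ≤ size H
    r-lower S⊆
      with neighbour H conn (S⊆ (there (∈-∖⁺ (∈-D⁺ d-first)
               λ e → <⇒≢ 1<m (cong value (d-injective e)))))
             (S⊆ (here refl)) (λ ())
         | neighbour H conn (S⊆ (there (∈-∖⁺ (∈-D⁺ d-last)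
               λ e → >⇒≢ m<k (cong value (d-injective e)))))
             (S⊆ (here refl)) (λ ())
    ... | _ , bwd (b-d m≤1 _) , _ | _ = contradiction (<-≤-trans 1<m m≤1) (<-irrefl refl)
    ... | _ , bwd (a-d _ _) , _ | _ , bwd (a-d k≤m _) , _ =
      contradiction (<-≤-trans m<k k≤m) (<-irrefl refl)
    ... | _ , bwd (a-d _ _) , y∈ | _ , bwd (b-d _ _) , z∈ = D∖-lower d-mid
      (((λ ()) ∷ (λ ()) ∷ []) ∷ ((λ ()) ∷ []) ∷ [] ∷ [])
      ((λ _ ()) ∷ (λ _ ()) ∷ (λ _ ()) ∷ []) y∈ z∈ S⊆

  -- Upper bounds by explicit trees.

  -- The choice is total so that parent is a function, but it is constrained on T only.
  tree : ∀ {S T x} → r ∈ T → (∀ j → ∃[ v ] (d j ∈ T → v ∈ T × Edge v (d j))) →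
         S ⊆ T → length T ≤ suc x → Covers S x
  tree {T = T} r∈ choice S⊆T length≤ with parent-tree r parent r∈ refl step
    where
    parent : V → V
    parent (d j) = proj₁ (choice j)
    parent (a _) = r
    parent (b _) = r
    parent r     = r

    parent-Edge : ∀ {v j} → Edge v (d j) → parent v ≡ r
    parent-Edge (a-d _ _) = refl
    parent-Edge (b-d _ _) = refl

    step : ∀ {v} → v ∈ T → v ≢ r → parent v ∈ T × v ~ parent v × parent (parent v) ≡ r
    step {d j} v∈ _ = let p∈ , e = proj₂ (choice j) v∈ in p∈ , bwd e , parent-Edge e
    step {a _} _ _  = r∈ , bwd r-a , refl
    step {b _} _ _  = r∈ , bwd r-b , refl
    step {r} _ r≢r  = contradiction refl r≢r
  ... | H , conn , T⊆ , size< = H , conn , T⊆ ∘ S⊆T , ≤-pred (≤-trans size< length≤)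

  -- a_i is adjacent to all of D₁ except d_i, which `T` omits, and b_m takes every d_j with j > m.
  a-tree : ∀ {S T x} i → d (d-of-a i) ∉ T → r ∈ T → a i ∈ T → b b-mid ∈ T →
           S ⊆ T → length T ≤ suc x → Covers S x
  a-tree {T = T} i d∉ r∈ a∈ b∈ = tree r∈ choice
    where
    choice : ∀ j → ∃[ v ] (d j ∈ T → v ∈ T × Edge v (d j))
    choice j with value j ≤?ℕ m
    ... | yes j≤m = a i , λ dj∈ → a∈ ,
      a-d j≤m λ j≡i → d∉ (subst (_∈ T) (cong d (value-injective j≡i)) dj∈)
    ... | no  j≰m = b b-mid , λ _ → b∈ , b-d (<⇒≤ (≰⇒> j≰m)) (>⇒≢ (≰⇒> j≰m))

  b-tree : ∀ {S T x} i → d (d-of-b i) ∉ T → r ∈ T → b i ∈ T → a a-mid ∈ T →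
           S ⊆ T → length T ≤ suc x → Covers S x
  b-tree {T = T} i d∉ r∈ b∈ a∈ = tree r∈ choice
    where
    choice : ∀ j → ∃[ v ] (d j ∈ T → v ∈ T × Edge v (d j))
    choice j with m ≤?ℕ value j
    ... | yes m≤j = b i , λ dj∈ → b∈ ,
      b-d m≤j λ j≡i → d∉ (subst (_∈ T) (cong d (value-injective j≡i)) dj∈)
    ... | no  m≰j = a a-mid , λ _ → a∈ , a-d (<⇒≤ (≰⇒> m≰j)) (<⇒≢ (≰⇒> m≰j))

  upper : ∀ {S} → length S ≡ k → Covers S (3 + k)
  upper {S} length≡ = tree {T = r ∷ a a-mid ∷ b b-mid ∷ a a-first ∷ S} (here refl) choice
    (there ∘ there ∘ there ∘ there) (≤-reflexive (cong (4 +_) length≡))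
    where
    choice : ∀ j → ∃[ v ] (d j ∈ _ → v ∈ _ × Edge v (d j))
    -- a_m takes the indices below m and b_m those above; d_m is adjacent to neither, and a_1 takes
    -- it because m ≠ 1.
    choice j with <-cmp (value j) m
    ... | tri< j<m _ _ = _ , λ _ → there (here refl) , a-d (<⇒≤ j<m) (<⇒≢ j<m)
    ... | tri≈ _ refl _ = _ , λ _ → there (there (there (here refl))) , a-d ≤-refl (>⇒≢ 1<m)
    ... | tri> _ _ j>m = _ , λ _ → there (there (here refl)) , b-d (<⇒≤ j>m) (>⇒≢ j>m)

  r-upper : ∀ {S} → Unique S → length S ≡ k → r ∈ S → Covers S (suc k)
  r-upper {S} uS length≡ r∈ with All.all? (_∈? S) D
  -- Otherwise `r ∷ D` would be k + 1 distinct elements of `S`.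
  ... | yes D⊆S = contradiction
    (≤-trans (s≤s (≤-reflexive (sym length-D)))
      (Unique-⊆⇒length-≤ {r ∷ D} (All.tabulate (λ { v∈ refl → Aux⇒∉D (λ _ ()) v∈ }) ∷ Unique-D)
        λ { (here refl) → r∈ ; (there v∈) → All.lookup D⊆S v∈ }))
    (<-irrefl (sym length≡))
  ... | no ¬D⊆S with find (¬All⇒Any¬ (_∈? S) D ¬D⊆S)
  ... | v , v∈D , v∉S with ∈-D⁻ v∈D
  ... | j , refl with ≤-total (value j) m
  -- The root is already in `S`, so `T` has only k + 2 entries and the tree at most k + 1 edges.
  ...   | inj₁ j≤m = a-tree {T = a i ∷ b b-mid ∷ S} i
    (λ { (there (there d∈)) → v∉S d∈ }) (there (there r∈)) (here refl) (there (here refl))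
    (there ∘ there) (≤-reflexive (cong (2 +_) length≡))
    where
    i : Range 1 m
    i = value j , [ proj₁ (bounds j) , j≤m ]
  ...   | inj₂ m≤j = b-tree {T = b i ∷ a a-mid ∷ S} i
    (λ { (there (there d∈)) → v∉S d∈ }) (there (there r∈)) (here refl) (there (here refl))
    (there ∘ there) (≤-reflexive (cong (2 +_) length≡))
    where
    i : Range m k
    i = value j , [ m≤j , proj₂ (bounds j) ]

  a-upper : ∀ i → Covers (a i ∷ (D ∖ d (d-of-a i))) (suc k)
  a-upper i = a-tree {T = r ∷ b b-mid ∷ a i ∷ (D ∖ d (d-of-a i))} i
    (λ { (there (there (there d∈))) → proj₂ (∈-∖⁻ {D} d∈) refl })
    (here refl) (there (there (here refl))) (there (here refl))
    (there ∘ there) (≤-reflexive (cong (suc ∘ suc) (length-∷-D∖ (a i) (d-of-a i))))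

  b-upper : ∀ i → Covers (b i ∷ (D ∖ d (d-of-b i))) (suc k)
  b-upper i = b-tree {T = r ∷ a a-mid ∷ b i ∷ (D ∖ d (d-of-b i))} i
    (λ { (there (there (there d∈))) → proj₂ (∈-∖⁻ {D} d∈) refl })
    (here refl) (there (there (here refl))) (there (here refl))
    (there ∘ there) (≤-reflexive (cong (suc ∘ suc) (length-∷-D∖ (b i) (d-of-b i))))

  -- Steiner distances of the extremal sets, diameter and radius.

  Distance : List V → ℕ → Set
  Distance = SteinerDistance (G k 5≤k)

  exact : ∀ {S x} → (∀ H → IsConnected H → S ⊆ verts H → x ≤ size H) → Covers S x → Distance S x
  exact lower (H , conn , S⊆ , size≤) =
    (H , conn , S⊆ , ≤-antisym size≤ (lower H conn S⊆)) ,
    λ { _ (H′ , conn′ , S⊆′ , refl) → lower H′ conn′ S⊆′ }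

  Distance-≤ : ∀ {S x y} → Distance S y → Covers S x → y ≤ x
  Distance-≤ (_ , minimal) (H , conn , S⊆ , size≤) =
    ≤-trans (minimal (size H) (H , conn , S⊆ , refl)) size≤

  HasDistance : V → ℕ → Set
  HasDistance v x = ∃[ S ] Unique S × length S ≡ k × v ∈ S × Distance S x

  d-distance : ∀ i → HasDistance (d i) (3 + k)
  d-distance i = D , Unique-D , length-D , ∈-D⁺ i ,
    exact (λ H conn D⊆ → D-lower H conn (D⊆ ∘ ∈-D⁺)) (upper length-D)

  a-distance : ∀ i → HasDistance (a i) (suc k)
  a-distance i = _ , Unique-∷-D∖ (d-of-a i) (λ _ ()) , length-∷-D∖ (a i) (d-of-a i) , here refl ,
    exact (λ H conn → a-lower H conn i) (a-upper i)

  b-distance : ∀ i → HasDistance (b i) (suc k)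
  b-distance i = _ , Unique-∷-D∖ (d-of-b i) (λ _ ()) , length-∷-D∖ (b i) (d-of-b i) , here refl ,
    exact (λ H conn → b-lower H conn i) (b-upper i)

  r-distance : HasDistance r (suc k)
  r-distance = _ , u , length-∷-D∖ r d-mid , here refl ,
    exact r-lower (r-upper u (length-∷-D∖ r d-mid) (here refl))
    where
    u : Unique (r ∷ (D ∖ d d-mid))
    u = Unique-∷-D∖ d-mid λ _ ()

  diameter : SteinerDiameter (G k 5≤k) k (3 + k)
  diameter =
    -- Any d_i attains the maximum, since D contains them all; the upper bound holds for every
    -- k-set, whatever vertex it contains.
    (d d-first , d-distance d-first ,
      λ { _ (_ , _ , length≡ , _ , dist) → Distance-≤ dist (upper length≡) }) ,
    λ { _ (_ , (_ , _ , length≡ , _ , dist) , _) → Distance-≤ dist (upper length≡) }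

  radius : SteinerRadius (G k 5≤k) k (suc k)
  radius =
    (r , r-distance ,
      λ { _ (_ , u , length≡ , r∈ , dist) → Distance-≤ dist (r-upper u length≡ r∈) }) ,
    λ { _ (v , _ , maximal) → eccentric v maximal }
    where
    -- One k-set through `v` of distance at least k + 1 is enough; exact eccentricities of the
    -- vertices other than `r` are not computed here.
    eccentric : ∀ {y} v → (∀ x → HasDistance v x → x ≤ y) → suc k ≤ y
    eccentric (d i) maximal = ≤-trans (s≤s (m≤n+m k 2)) (maximal _ (d-distance i))
    eccentric (a i) maximal = maximal _ (a-distance i)
    eccentric (b i) maximal = maximal _ (b-distance i)
    eccentric r     maximal = maximal _ r-distance

proposition10 : (k : ℕ) (5≤k : 5 ≤ k) →
    SteinerDiameter (G k 5≤k) k (k + 3) × SteinerRadius (G k 5≤k) k (k + 1)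
proposition10 k 5≤k =
  subst (SteinerDiameter (G k 5≤k) k) (+-comm 3 k) diameter ,
  subst (SteinerRadius (G k 5≤k) k) (+-comm 1 k) radius
  where open Proof k 5≤k
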